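{- For all integers $s\geq 1$, we have $$\mathrm{EN}_{s,2}(2143)(q)=q^{(2s-1)(s-1)}(1+q)^{s-1}.$$
   Context: For integers $s,t\ge 1$, $\mathrm{EN}_{s,t}$ is the rectangular poset on the label set $\{1,\ldots,st\}$ whose labels are arranged in $s$ rows of length $t$, row $i$ (for $0\le i\le s-1$) being $it+1,it+2,\ldots,it+t$, and whose order is generated by the relations $it+j<_{\mathrm{EN}} it+j+1$ for $0\le i\le s-1$, $1\le j\le t-1$, and $(i+1)t+j<_{\mathrm{EN}} it+j$ for $0\le i\le s-2$, $1\le j\le t$. A linear extension of $\mathrm{EN}_{s,t}$ is viewed as a permutation $\pi=\pi_1\cdots\pi_{st}\in S_{st}$ of the labels in which $a$ appears before $b$ whenever $a<_{\mathrm{EN}}b$. For example, the linear extensions of $\mathrm{EN}_{3,2}$ are $531642,536142,536412,563142,563412$. A permutation $\sigma=\sigma_1\cdots\sigma_n$ contains the pattern $\tau=\tau_1\cdots\tau_m\in S_m$ if there are indices $i_1<\cdots<i_m$ such that for all $j,l\in\{1,\ldots,m\}$ one has $\sigma_{i_j}<\sigma_{i_l}$ if and only if $\tau_j<\tau_l$; otherwise $\sigma$ avoids $\tau$. $\mathrm{EN}_{s,t}(\tau)$ is the set of linear extensions of $\mathrm{EN}_{s,t}$ that avoid $\tau$. An inversion of $\pi$ is a pair $(i,j)$ with $i<j$ and $\pi_i>\pi_j$, and $\mathrm{inv}(\pi)$ is the number of inversions of $\pi$. Finally, $\mathrm{EN}_{s,t}(\tau)(q)=\sum_{\pi\in \mathrm{EN}_{s,t}(\tau)}q^{\mathrm{inv}(\pi)}$.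 -}

module Defs where

open import Algebra.Bundles.Raw using (RawSemiring)
open import Data.Fin.Base using (Fin; zero; suc; toℕ; combine; _<_)
open import Data.Fin.Properties using (_≟_; _<?_; <-trans; any?; all?)
open import Data.List.Base using (List; []; _∷_; map; foldr; filter; length; allFin; cartesianProduct; cartesianProductWith)
open import Data.List.Membership.Propositional using (_∈_; find; lose)
open import Data.List.Membership.Propositional.Properties using (∈-allFin; ∈-cartesianProductWith⁺)
import Data.List.Relation.Unary.Any as Any
open import Data.Nat.Base as ℕ using (ℕ; zero; suc)
import Data.Nat.Properties as ℕ
open import Data.Product.Base using (∃; ∃₂; _×_; _,_; proj₁)
open import Data.Vec.Base using (Vec; []; _∷_; lookup)
open import Data.Vec.Relation.Unary.AllPairs using (AllPairs; allPairs?)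
open import Data.Vec.Relation.Unary.Unique.Propositional using (Unique)
open import Data.Vec.Relation.Unary.Unique.Propositional.Properties using (lookup-injective)
open import Function.Base using (_∘_)
open import Function.Bundles using (_⇔_; mk⇔; Equivalence)
open import Level using (0ℓ)
open import Relation.Binary.Core using (Rel)
open import Relation.Binary.Construct.Closure.Transitive using (TransClosure; [_]; _∷_)
open import Relation.Binary.PropositionalEquality.Core using (_≡_; refl; sym; trans; subst)
open import Relation.Nullary.Decidable using (Dec; yes; no; map′; _×-dec_; _→-dec_; ¬?)
open import Relation.Nullary.Negation.Core using (¬_)
open import Relation.Unary using (Pred; Decidable)

-- The letters 1, …, n are the elements of Fin n: the letter ℓ is the
-- element with toℕ equal to ℓ - 1. Permutations are the words
-- satisfying Unique (n distinct letters from an n-letter alphabet).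

Word : ℕ → ℕ → Set
Word n m = Vec (Fin n) m

allWords : ∀ n m → List (Word n m)
allWords n zero    = [] ∷ []
allWords n (suc m) = cartesianProductWith _∷_ (allFin n) (allWords n m)

allWords-complete : ∀ {n m} (w : Word n m) → w ∈ allWords n m
allWords-complete []      = Any.here refl
allWords-complete (x ∷ w) =
  ∈-cartesianProductWith⁺ _∷_ (∈-allFin x) (allWords-complete w)

∃Word? : ∀ {n m} {P : Pred (Word n m) 0ℓ} → Decidable P → Dec (∃ P)
∃Word? P? = map′
  (λ any → let w , _ , Pw = find any in w , Pw)
  (λ (w , Pw) → lose (allWords-complete w) Pw)
  (Any.any? P? (allWords _ _))

unique? : ∀ {n m} → Decidable (Unique {A = Fin n} {m})
unique? = allPairs? (λ x y → ¬? (x ≟ y))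

Inversion : ∀ {n} → Word n n → Pred (Fin n × Fin n) 0ℓ
Inversion π (i , j) = i < j × lookup π j < lookup π i

inversion? : ∀ {n} (π : Word n n) → Decidable (Inversion π)
inversion? π (i , j) = i <? j ×-dec lookup π j <? lookup π i

inv : ∀ {n} → Word n n → ℕ
inv {n} π = length (filter (inversion? π) (cartesianProduct (allFin n) (allFin n)))

_Contains_ : ∀ {n m} → Word n n → Word m m → Set
_Contains_ {n} {m} σ τ = ∃ λ (i : Vec (Fin n) m) →
  AllPairs _<_ i ×
  (∀ j l → lookup σ (lookup i j) < lookup σ (lookup i l)
           ⇔ lookup τ j < lookup τ l)

_Avoids_ : ∀ {n m} → Word n n → Word m m → Set
σ Avoids τ = ¬ (σ Contains τ)

_⇔?_ : ∀ {A B : Set} → Dec A → Dec B → Dec (A ⇔ B)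
a? ⇔? b? = map′
  (λ (f , g) → mk⇔ f g)
  (λ e → Equivalence.to e , Equivalence.from e)
  ((a? →-dec b?) ×-dec (b? →-dec a?))

_contains?_ : ∀ {n m} (σ : Word n n) (τ : Word m m) → Dec (σ Contains τ)
σ contains? τ = ∃Word? λ i →
  allPairs? _<?_ i ×-dec
  all? λ j → all? λ l →
    (lookup σ (lookup i j) <? lookup σ (lookup i l))
    ⇔? (lookup τ j <? lookup τ l)

Precedes : ∀ {n m} → Word n m → Rel (Fin n) 0ℓ
Precedes π a b = ∃₂ λ i j → i < j × lookup π i ≡ a × lookup π j ≡ b

precedes? : ∀ {n m} (π : Word n m) a b → Dec (Precedes π a b)
precedes? π a b = any? λ i → any? λ j →
  i <? j ×-dec (lookup π i ≟ a ×-dec lookup π j ≟ b)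

precedes-trans : ∀ {n m} {π : Word n m} → Unique π →
                 ∀ {a b c} → Precedes π a b → Precedes π b c → Precedes π a c
precedes-trans u (i , j , i<j , πi≡a , πj≡b) (k , l , k<l , πk≡b , πl≡c) =
  i , l ,
  <-trans i<j (subst (_< l) (lookup-injective u k j (trans πk≡b (sym πj≡b))) k<l) ,
  πi≡a , πl≡c

IsLinearExtension : ∀ {n} → Rel (Fin n) 0ℓ → Word n n → Set
IsLinearExtension _≺_ π = Unique π × (∀ a b → a ≺ b → Precedes π a b)

-- combine i j is the label it + (j + 1), as toℕ (combine i j) is
-- t * toℕ i + toℕ j; both the row i and the column j count from 0.

data Gen (s t : ℕ) : Rel (Fin (s ℕ.* t)) 0ℓ where
  alongRow : ∀ (i : Fin s) (j j′ : Fin t) → toℕ j′ ≡ suc (toℕ j) →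
             Gen s t (combine i j) (combine i j′)
  upColumn : ∀ (i i′ : Fin s) (j : Fin t) → toℕ i′ ≡ suc (toℕ i) →
             Gen s t (combine i′ j) (combine i j)

EN-Order : ∀ s t → Rel (Fin (s ℕ.* t)) 0ℓ
EN-Order s t = TransClosure (Gen s t)

isLinearExtension? : ∀ s t → Decidable (IsLinearExtension (EN-Order s t))
isLinearExtension? s t π with unique? π
... | no ¬u = no (¬u ∘ proj₁)
... | yes u = map′
  (λ (row , col) → u , λ _ _ → closure row col)
  (λ (_ , ext) →
    (λ i j j′ eq → ext _ _ [ alongRow i j j′ eq ]) ,
    (λ i i′ j eq → ext _ _ [ upColumn i i′ j eq ]))
  ((all? λ i → all? λ j → all? λ j′ →
      (toℕ j′ ℕ.≟ suc (toℕ j)) →-dec precedes? π (combine i j) (combine i j′))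
   ×-dec
   (all? λ i → all? λ i′ → all? λ j →
      (toℕ i′ ℕ.≟ suc (toℕ i)) →-dec precedes? π (combine i′ j) (combine i j)))
  where
  RowCond = ∀ (i : Fin s) (j j′ : Fin t) → toℕ j′ ≡ suc (toℕ j) →
            Precedes π (combine i j) (combine i j′)
  ColCond = ∀ (i i′ : Fin s) (j : Fin t) → toℕ i′ ≡ suc (toℕ i) →
            Precedes π (combine i′ j) (combine i j)

  gen : RowCond → ColCond → ∀ {a b} → Gen s t a b → Precedes π a b
  gen row col (alongRow i j j′ eq) = row i j j′ eq
  gen row col (upColumn i i′ j eq) = col i i′ j eq

  closure : RowCond → ColCond → ∀ {a b} → EN-Order s t a b → Precedes π a b
  closure row col [ g ]    = gen row col g
  closure row col (g ∷ gs) = precedes-trans u (gen row col g) (closure row col gs)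

InEN : ∀ {m} (s t : ℕ) → Word m m → Pred (Word (s ℕ.* t) (s ℕ.* t)) 0ℓ
InEN s t τ π = IsLinearExtension (EN-Order s t) π × π Avoids τ

inEN? : ∀ {m} (s t : ℕ) (τ : Word m m) → Decidable (InEN s t τ)
inEN? s t τ π = isLinearExtension? s t π ×-dec ¬? (π contains? τ)

-- A duplicate-free enumeration, as allWords lists every word exactly once.
EN : ∀ {m} (s t : ℕ) → Word m m → List (Word (s ℕ.* t) (s ℕ.* t))
EN s t τ = filter (inEN? s t τ) (allWords (s ℕ.* t) (s ℕ.* t))

-- Coefficient lists, constant term first; trailing zeros are allowed,
-- so equality of polynomials is equality of all coefficients.

Poly : Set
Poly = List ℕ

coeff : Poly → ℕ → ℕ
coeff []      _       = 0
coeff (a ∷ _) zero    = a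
coeff (_ ∷ f) (suc k) = coeff f k

infix  4 _≈ₚ_
infixl 6 _+ₚ_
infixl 7 _*ₚ_

_≈ₚ_ : Rel Poly 0ℓ
f ≈ₚ g = ∀ k → coeff f k ≡ coeff g k

_+ₚ_ : Poly → Poly → Poly
[]      +ₚ g       = g
(a ∷ f) +ₚ []      = a ∷ f
(a ∷ f) +ₚ (b ∷ g) = a ℕ.+ b ∷ f +ₚ g

_*ₚ_ : Poly → Poly → Poly
[]      *ₚ g = []
(a ∷ f) *ₚ g = map (a ℕ.*_) g +ₚ (0 ∷ f *ₚ g)

0ₚ 1ₚ q : Poly
0ₚ = []
1ₚ = 1 ∷ []
q  = 0 ∷ 1 ∷ []

ℕ[q] : RawSemiring 0ℓ 0ℓ
ℕ[q] = record
  { Carrier = Poly ; _≈_ = _≈ₚ_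
  ; _+_ = _+ₚ_ ; _*_ = _*ₚ_ ; 0# = 0ₚ ; 1# = 1ₚ }

open import Algebra.Definitions.RawSemiring ℕ[q] public
  using () renaming (_^_ to _^ₚ_)

ENPoly : ∀ {m} (s t : ℕ) → Word m m → Poly
ENPoly s t τ = foldr _+ₚ_ 0ₚ (map (λ π → q ^ₚ inv π) (EN s t τ))

-- The permutation 2143, in letters counted from 0.
pattern2143 : Word 4 4
pattern2143 = suc zero ∷ zero ∷ suc (suc (suc zero)) ∷ suc (suc zero) ∷ []

{-# OPTIONS --safe #-}
module Submission where

-- Removing the top row (the two largest letters) from a linear extension of
-- EN_{m+2,2} leaves one of EN_{m+1,2}. Conversely the smaller of the two letters
-- must be put in front, and 2143 is avoided exactly when the larger one is put
-- directly after it or one place further (and the rest avoids 2143). With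
-- N = 2m + 2 remaining letters, the two choices add 2N and 2N - 1 inversions, so
-- the generating function is multiplied by q^(2N-1) (1 + q).

open import Defs
open import Data.Fin.Base using (Fin; zero; suc; toℕ; fromℕ; inject₁; combine; punchIn; _<_)
open import Data.Fin.Properties
  using (_≟_; _<?_; toℕ-injective; toℕ-fromℕ; toℕ-inject₁; toℕ-combine; toℕ<n; inject₁-injective;
         fromℕ≢inject₁; combine-surjective; punchIn-injective; punchIn-mono-≤; punchIn-cancel-≤;
         punchIn-punchOut; punchOut-punchIn; punchInᵢ≢i; suc-injective; ≤∧≢⇒<; <⇒≢; <-cmp)
open import Data.Fin.Relation.Unary.Top using (view; ‵fromℕ; ‵inject₁)
open import Data.List.Base as List
  using (List; []; _∷_; foldr; filter; length; allFin; cartesianProduct)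
open import Data.List.Membership.Propositional using (_∈_)
open import Data.List.Membership.Propositional.Properties
  using (∈-filter⁺; ∈-filter⁻; ∈-map⁺; ∈-map⁻; ∈-++⁺ˡ; ∈-++⁺ʳ; ∈-++⁻)
open import Data.List.Membership.Propositional.Properties.WithK using (unique∧set⇒bag)
import Data.List.Properties as List
open import Data.List.Relation.Binary.BagAndSetEquality using (∼bag⇒↭)
import Data.List.Relation.Binary.Disjoint.Propositional as List
open import Data.List.Relation.Binary.Permutation.Propositional using (_↭_)
open import Data.List.Relation.Binary.Permutation.Propositional.Properties renaming (map⁺ to ↭-map⁺) using ()
open import Data.List.Relation.Unary.All using ([])
open import Data.List.Relation.Unary.AllPairs using ([]; _∷_)
import Data.List.Relation.Unary.Unique.Propositional as List
import Data.List.Relation.Unary.Unique.Propositional.Properties as List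
open import Data.Nat.Base using (ℕ; zero; suc; _≥_; _+_; _*_; _∸_; _≤_; z≤n; s≤s; s≤s⁻¹)
open import Data.Nat.ListAction using (sum)
open import Data.Nat.ListAction.Properties using (sum-↭; sum-++)
import Data.Nat.Base as ℕ using (_<_)
import Data.Nat.Properties as ℕ
open import Data.Nat.Tactic.RingSolver using (solve-∀)
open import Data.Product.Base as Product using (∃; _×_; _,_; proj₂)
open import Data.Sum.Base using (inj₁; inj₂)
open import Data.Vec.Base using (Vec; []; _∷_; lookup; map; count; insertAt; removeAt; tabulate)
open import Data.Vec.Properties
  using (lookup-map; insertAt-lookup; insertAt-punchIn; insertAt-removeAt; removeAt-punchOut; tabulate∘lookup; tabulate-cong; ∷-injective)
open import Data.Vec.Relation.Unary.All using ([]; _∷_)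
import Data.Vec.Relation.Unary.All.Properties as All
open import Data.Vec.Relation.Unary.AllPairs using (AllPairs; []; _∷_)
open import Data.Vec.Relation.Unary.Unique.Propositional using (Unique)
open import Data.Vec.Relation.Unary.Unique.Propositional.Properties using (lookup-injective; tabulate⁺)
open import Function.Base using (_∘_; id)
open import Function.Bundles using (_⇔_; mk⇔; Equivalence)
open import Level using (0ℓ)
open import Relation.Binary.Core using (Rel)
open import Relation.Binary.Construct.Closure.Transitive using ([_]; _∷_)
open import Relation.Binary.Definitions using (tri<; tri≈; tri>)
open import Relation.Binary.PropositionalEquality
open import Relation.Nullary.Decidable using (_×-dec_)
open import Relation.Unary using (Pred; Decidable)
open import Relation.Nullary using (¬_; yes; no; contradiction)

-- The front place is forced because every letter except the left end of the top row has a
-- predecessor: a right end comes after its left end, and `x` comes after `x + 2`. Over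
-- `N = 2, 4, ..., 2s - 2` the smaller of the two increments, `2N - 1`, runs through 3, 7, ..., 4s -
-- 5, whose sum is the exponent `(2s - 1)(s - 1)`. Each of these `s - 1` steps contributes one
-- factor `1 + q`. The recursion starts from the single word 12, without inversions. As `Poly`
-- allows trailing zeros, equal polynomials may be lists of different lengths, so the algebra is
-- carried out coefficient by coefficient.

private variable
  m n : ℕ

-- Inserting the two largest letters into a word

low : Fin n → Fin (2 + n)
low x = inject₁ (inject₁ x)

-- The ends of the top row, above the n letters of the lower rows.
left right : ∀ n → Fin (2 + n)
left  n = inject₁ (fromℕ n)
right n = fromℕ (suc n)

data Letter {n} : Fin (2 + n) → Set where
  isLeft  : Letter (left n)
  isRight : Letter (right n)
  isLow   : ∀ x → Letter (low x)

letter : (a : Fin (2 + n)) → Letter a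
letter a with view a
... | ‵fromℕ = isRight
... | ‵inject₁ b with view b
...   | ‵fromℕ     = isLeft
...   | ‵inject₁ x = isLow x

toℕ-low : (x : Fin n) → toℕ (low x) ≡ toℕ x
toℕ-low x = trans (toℕ-inject₁ (inject₁ x)) (toℕ-inject₁ x)

toℕ-left : ∀ n → toℕ (left n) ≡ n
toℕ-left n = trans (toℕ-inject₁ (fromℕ n)) (toℕ-fromℕ n)

low-injective : {x y : Fin n} → low x ≡ low y → x ≡ y
low-injective = inject₁-injective ∘ inject₁-injective

low≢left : {x : Fin n} → low x ≢ left n
low≢left = fromℕ≢inject₁ ∘ sym ∘ inject₁-injective

low≢right : {x : Fin n} → low x ≢ right n
low≢right = fromℕ≢inject₁ ∘ sym

left≢right : left n ≢ right n
left≢right = fromℕ≢inject₁ ∘ sym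

low-mono-< : {x y : Fin n} → x < y → low x < low y
low-mono-< {x = x} {y} = subst₂ ℕ._<_ (sym (toℕ-low x)) (sym (toℕ-low y))

low-cancel-< : {x y : Fin n} → low x < low y → x < y
low-cancel-< {x = x} {y} = subst₂ ℕ._<_ (toℕ-low x) (toℕ-low y)

low<left : (x : Fin n) → low x < left n
low<left {n} x = subst₂ ℕ._<_ (sym (toℕ-low x)) (sym (toℕ-left n)) (toℕ<n x)

left<right : ∀ n → left n < right n
left<right n = subst₂ ℕ._<_ (sym (toℕ-left n)) (sym (toℕ-fromℕ (suc n))) (ℕ.n<1+n n)

low<right : (x : Fin n) → low x < right n
low<right {n} x = ℕ.<-trans (low<left x) (left<right n)

right-max : (a : Fin (2 + n)) → ¬ right n < a
right-max {n} a r<a = ℕ.<⇒≱ r<a (subst (toℕ a ≤_) (sym (toℕ-fromℕ (suc n))) (s≤s⁻¹ (toℕ<n a)))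

-- New position of the entry `i` of the old word: `suc` makes room for the leading letter,
-- `punchIn p` for the largest one.
slot : Fin (suc n) → Fin n → Fin (2 + n)
slot p i = suc (punchIn p i)

data Position {n} (p : Fin (suc n)) : Fin (2 + n) → Set where
  first   : Position p zero
  ofRight : Position p (suc p)
  slotted : ∀ i → Position p (slot p i)

position : (p : Fin (suc n)) (k : Fin (2 + n)) → Position p k
position p zero    = first
position p (suc k) with p ≟ k
... | yes refl = ofRight
... | no p≢k   = subst (Position p ∘ suc) (punchIn-punchOut p≢k) (slotted _)

slot-mono-< : (p : Fin (suc n)) {i j : Fin n} → i < j → slot p i < slot p j
slot-mono-< p {i} {j} i<j =
  s≤s (≤∧≢⇒< (punchIn-mono-≤ p i j (ℕ.<⇒≤ i<j)) (<⇒≢ i<j ∘ punchIn-injective p i j))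

slot-cancel-< : (p : Fin (suc n)) {i j : Fin n} → slot p i < slot p j → i < j
slot-cancel-< p {i} {j} (s≤s pi<pj) =
  ≤∧≢⇒< (punchIn-cancel-≤ p i j (ℕ.<⇒≤ pi<pj)) (<⇒≢ pi<pj ∘ cong (punchIn p))

p<punchIn : (p : Fin (suc n)) (i : Fin n) → toℕ p ≤ toℕ i → p < punchIn p i
p<punchIn zero    i       _         = s≤s z≤n
p<punchIn (suc p) (suc i) (s≤s p≤i) = s≤s (p<punchIn p i p≤i)

-- Only the place of the largest letter is a parameter, since the other new letter heads every
-- linear extension.
ins : Fin (suc n) → Word n n → Word (2 + n) (2 + n)
ins {n} p w = left n ∷ insertAt (map low w) p (right n)

module _ (p : Fin (suc n)) (w : Word n n) where

  lookup-ins-right : lookup (ins p w) (suc p) ≡ right n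
  lookup-ins-right = insertAt-lookup (map low w) p (right n)

  lookup-ins-slot : ∀ i → lookup (ins p w) (slot p i) ≡ low (lookup w i)
  lookup-ins-slot i = trans (insertAt-punchIn (map low w) p (right n) i) (lookup-map i low w)

  lookup-ins-slot-< : ∀ {i j} → lookup w i < lookup w j →
                      lookup (ins p w) (slot p i) < lookup (ins p w) (slot p j)
  lookup-ins-slot-< {i} {j} =
    subst₂ _<_ (sym (lookup-ins-slot i)) (sym (lookup-ins-slot j)) ∘ low-mono-<

  lookup-ins-slot-<⁻ : ∀ {i j} → lookup (ins p w) (slot p i) < lookup (ins p w) (slot p j) →
                       lookup w i < lookup w j
  lookup-ins-slot-<⁻ {i} {j} =
    low-cancel-< ∘ subst₂ _<_ (lookup-ins-slot i) (lookup-ins-slot j)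

  precedes-ins : ∀ {a b} → Precedes w a b → Precedes (ins p w) (low a) (low b)
  precedes-ins (i , j , i<j , refl , refl) =
    slot p i , slot p j , slot-mono-< p i<j , lookup-ins-slot i , lookup-ins-slot j

  slot-of-low : ∀ {k a} → lookup (ins p w) k ≡ low a → ∃ λ i → k ≡ slot p i × lookup w i ≡ a
  slot-of-low {k} eq with position p k
  ... | first     = contradiction (sym eq) low≢left
  ... | ofRight   = contradiction (trans (sym eq) lookup-ins-right) low≢right
  ... | slotted i = i , refl , low-injective (trans (sym (lookup-ins-slot i)) eq)

  precedes-ins⁻ : ∀ {a b} → Precedes (ins p w) (low a) (low b) → Precedes w a b
  precedes-ins⁻ (k , l , k<l , πk≡ , πl≡) with slot-of-low {k} πk≡ | slot-of-low {l} πl≡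
  ... | i , refl , wi≡a | j , refl , wj≡b = i , j , slot-cancel-< p k<l , wi≡a , wj≡b

injective⇒unique : {w : Word n m} → (∀ i j → lookup w i ≡ lookup w j → i ≡ j) → Unique w
injective⇒unique {w = w} inj = subst Unique (tabulate∘lookup w) (tabulate⁺ (inj _ _))

module _ (p : Fin (suc n)) {w : Word n n} where

  unique-ins : Unique w → Unique (ins p w)
  unique-ins u = injective⇒unique λ k l → inj (position p k) (position p l)
    where
    right≡ = lookup-ins-right p w
    slot≡  = lookup-ins-slot p w
    inj : ∀ {k l} → Position p k → Position p l →
          lookup (ins p w) k ≡ lookup (ins p w) l → k ≡ l
    inj first       first       _  = refl
    inj ofRight     ofRight     _  = refl
    inj first       ofRight     eq = contradiction (trans eq right≡) left≢right
    inj ofRight     first       eq = contradiction (trans (sym eq) right≡) left≢right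
    inj first       (slotted j) eq = contradiction (sym (trans eq (slot≡ j))) low≢left
    inj (slotted i) first       eq = contradiction (trans (sym (slot≡ i)) eq) low≢left
    inj ofRight     (slotted j) eq = contradiction (trans (sym (slot≡ j)) (trans (sym eq) right≡)) low≢right
    inj (slotted i) ofRight     eq = contradiction (trans (sym (slot≡ i)) (trans eq right≡)) low≢right
    inj (slotted i) (slotted j) eq = cong (slot p)
      (lookup-injective u i j (low-injective (trans (sym (slot≡ i)) (trans eq (slot≡ j)))))

  unique-ins⁻ : Unique (ins p w) → Unique w
  unique-ins⁻ u = injective⇒unique λ i j eq →
    punchIn-injective p i j (suc-injective (lookup-injective u (slot p i) (slot p j)
      (trans (lookup-ins-slot p w i) (trans (cong low eq) (sym (lookup-ins-slot p w j))))))

-- Occurrences of 2143 before and after the insertion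

-- The chain "1 < 2 < 3 < 4" of values in an occurrence. By transitivity it carries the same
-- information as the equivalences over all pairs in `Contains`, but it leaves only three
-- inequalities to transport.
record Has2143 (π : Word n n) : Set where
  constructor occurrence
  field
    {i j k l} : Fin n
    i<j : i < j
    j<k : j < k
    k<l : k < l
    πj<πi : lookup π j < lookup π i
    πi<πl : lookup π i < lookup π l
    πl<πk : lookup π l < lookup π k

contains⇒has2143 : {π : Word n n} → π Contains pattern2143 → Has2143 π
contains⇒has2143 (i ∷ j ∷ k ∷ l ∷ [] , (i<j ∷ _) ∷ (j<k ∷ _) ∷ (k<l ∷ []) ∷ [] ∷ [] , iso) =
  occurrence i<j j<k k<l
    (Equivalence.from (iso (suc zero) zero) (s≤s z≤n))
    (Equivalence.from (iso zero (suc (suc (suc zero)))) (s≤s (s≤s z≤n)))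
    (Equivalence.from (iso (suc (suc (suc zero))) (suc (suc zero))) (s≤s (s≤s (s≤s z≤n))))

module _ {v : Vec (Fin n) m} (sorted : AllPairs _<_ v) where

  lookup-mono-< : ∀ {i j} → i < j → lookup v i < lookup v j
  lookup-mono-< = go sorted
    where
    go : ∀ {m} {v : Vec (Fin n) m} → AllPairs _<_ v → ∀ {i j} → i < j → lookup v i < lookup v j
    go (x<v ∷ _) {zero}  {suc j} _         = All.lookup⁺ x<v j
    go (_ ∷ v<)  {suc i} {suc j} (s≤s i<j) = go v< i<j

  lookup-cancel-< : ∀ {i j} → lookup v i < lookup v j → i < j
  lookup-cancel-< {i} {j} vi<vj with <-cmp i j
  ... | tri< i<j _ _  = i<j
  ... | tri≈ _ refl _ = contradiction vi<vj (ℕ.<-irrefl refl)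
  ... | tri> _ _ j<i  = contradiction vi<vj (ℕ.<-asym (lookup-mono-< j<i))

chain : ∀ {a b c d : Fin n} → a < b → b < c → c < d → AllPairs _<_ (a ∷ b ∷ c ∷ d ∷ [])
chain a<b b<c c<d =
  (a<b ∷ ℕ.<-trans a<b b<c ∷ ℕ.<-trans a<b (ℕ.<-trans b<c c<d) ∷ []) ∷
  (b<c ∷ ℕ.<-trans b<c c<d ∷ []) ∷ (c<d ∷ []) ∷ [] ∷ []

has2143⇒contains : {π : Word n n} → Has2143 π → π Contains pattern2143
has2143⇒contains {π = π} (occurrence {i} {j} {k} {l} i<j j<k k<l πj<πi πi<πl πl<πk) =
  positions , chain i<j j<k k<l , λ a b → mk⇔
    (lookup-cancel-< sorted ∘ subst₂ _<_ (value a) (value b))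
    (subst₂ _<_ (sym (value a)) (sym (value b)) ∘ lookup-mono-< sorted)
  where
  positions = i ∷ j ∷ k ∷ l ∷ []
  -- Listed in increasing order of value, so that the rank `lookup pattern2143 a` is the index of
  -- the letter playing the role `a`.
  values    = lookup π j ∷ lookup π i ∷ lookup π l ∷ lookup π k ∷ []
  sorted    = chain πj<πi πi<πl πl<πk

  value : ∀ a → lookup π (lookup positions a) ≡ lookup values (lookup pattern2143 a)
  value zero                   = refl
  value (suc zero)             = refl
  value (suc (suc zero))       = refl
  value (suc (suc (suc zero))) = refl

has2143-ins : ∀ p (w : Word n n) → Has2143 w → Has2143 (ins p w)
has2143-ins p w (occurrence i<j j<k k<l πj<πi πi<πl πl<πk) = occurrence
  (slot-mono-< p i<j) (slot-mono-< p j<k) (slot-mono-< p k<l)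
  (lookup-ins-slot-< p w πj<πi) (lookup-ins-slot-< p w πi<πl) (lookup-ins-slot-< p w πl<πk)

module _ (p : Fin (suc n)) (w : Word n n) where

  private
    right≮ : ∀ k → ¬ lookup (ins p w) (suc p) < lookup (ins p w) k
    right≮ k = right-max _ ∘ subst (_< lookup (ins p w) k) (lookup-ins-right p w)

  -- An occurrence of 2143 using a new letter uses the largest letter as its 4,
  -- in the third position at least, which toℕ p ≤ 1 excludes.
  has2143-ins⁻ : toℕ p ≤ 1 → Has2143 (ins p w) → Has2143 w
  has2143-ins⁻ p≤1 (occurrence {i} {j} {k} {l} i<j j<k k<l πj<πi πi<πl πl<πk)
    with position p i | position p j | position p k | position p l
  ... | slotted _ | slotted _ | slotted _ | slotted _ = occurrence
    (slot-cancel-< p i<j) (slot-cancel-< p j<k) (slot-cancel-< p k<l)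
    (lookup-ins-slot-<⁻ p w πj<πi) (lookup-ins-slot-<⁻ p w πi<πl) (lookup-ins-slot-<⁻ p w πl<πk)
  ... | slotted _ | slotted _ | ofRight | _ =
    contradiction (ℕ.≤-trans (s≤s (ℕ.≤-trans (s≤s z≤n) (s≤s⁻¹ i<j))) (s≤s⁻¹ j<k)) (ℕ.≤⇒≯ p≤1)
  ... | ofRight | _ | _ | _ = contradiction πi<πl (right≮ l)
  ... | _ | ofRight | _ | _ = contradiction πj<πi (right≮ i)
  ... | _ | _ | _ | ofRight = contradiction πl<πk (right≮ k)
  ... | first | _ | ofRight | slotted b =
    contradiction (subst (left n <_) (lookup-ins-slot p w b) πi<πl) (ℕ.<-asym (low<left _))
  ... | first | _ | slotted b | _ =
    contradiction (subst (left n <_) (lookup-ins-slot p w b) (ℕ.<-trans πi<πl πl<πk)) (ℕ.<-asym (low<left _))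
  ... | _ | first | _ | _ = contradiction i<j λ ()
  ... | _ | _ | first | _ = contradiction j<k λ ()
  ... | _ | _ | _ | first = contradiction k<l λ ()

-- The generating relations after adding a row

-- Passing from m + 1 to m + 2 rows adds the row of the two largest letters,
-- and low keeps the labels of the other rows.
data GenView (m : ℕ) : Rel (Fin (suc (suc m) * 2)) 0ℓ where
  lower       : ∀ {a b} → Gen (suc m) 2 a b → GenView m (low a) (low b)
  topRow      : GenView m (left (suc m * 2)) (right (suc m * 2))
  leftColumn  : GenView m (left (suc m * 2)) (low (left (m * 2)))
  rightColumn : GenView m (right (suc m * 2)) (low (right (m * 2)))

low-combine : ∀ (i : Fin m) (j : Fin 2) → low (combine i j) ≡ combine (inject₁ i) j
low-combine i j = toℕ-injective (begin
  toℕ (low (combine i j))         ≡⟨ toℕ-low (combine i j) ⟩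
  toℕ (combine i j)               ≡⟨ toℕ-combine i j ⟩
  2 * toℕ i + toℕ j               ≡⟨ cong (λ x → 2 * x + toℕ j) (toℕ-inject₁ i) ⟨
  2 * toℕ (inject₁ i) + toℕ j     ≡⟨ toℕ-combine (inject₁ i) j ⟨
  toℕ (combine (inject₁ i) j)     ∎)
  where open ≡-Reasoning

toℕ-combine-fromℕ : ∀ m (j : Fin 2) → toℕ (combine (fromℕ m) j) ≡ m * 2 + toℕ j
toℕ-combine-fromℕ m j = begin
  toℕ (combine (fromℕ m) j)   ≡⟨ toℕ-combine (fromℕ m) j ⟩
  2 * toℕ (fromℕ m) + toℕ j   ≡⟨ cong (λ x → 2 * x + toℕ j) (toℕ-fromℕ m) ⟩
  2 * m + toℕ j               ≡⟨ cong (_+ toℕ j) (ℕ.*-comm 2 m) ⟩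
  m * 2 + toℕ j               ∎
  where open ≡-Reasoning

left-combine : ∀ m → left (m * 2) ≡ combine (fromℕ m) zero
left-combine m = toℕ-injective (trans (toℕ-left (m * 2))
  (sym (trans (toℕ-combine-fromℕ m zero) (ℕ.+-identityʳ (m * 2)))))

right-combine : ∀ m → right (m * 2) ≡ combine (fromℕ m) (suc zero)
right-combine m = toℕ-injective (trans (toℕ-fromℕ (suc (m * 2)))
  (sym (trans (toℕ-combine-fromℕ m (suc zero)) (ℕ.+-comm (m * 2) 1))))

gen-topRow : ∀ m → Gen (suc m) 2 (left (m * 2)) (right (m * 2))
gen-topRow m = subst₂ (Gen (suc m) 2) (sym (left-combine m)) (sym (right-combine m))
  (alongRow (fromℕ m) zero (suc zero) refl)

-- Neighbours in a column differ by the row length 2, and `combine (suc i) j` reduces to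
-- `suc (suc (combine i j))`.
gen-column : (x : Fin (m * 2)) → Gen (suc m) 2 (suc (suc x)) (low x)
gen-column {m} x with i , j , refl ← combine-surjective {m} {2} x =
  subst (Gen _ 2 _) (sym (low-combine i j)) (upColumn (inject₁ i) (suc i) j (cong suc (sym (toℕ-inject₁ i))))

genView⇒gen : ∀ {a b} → GenView m a b → Gen (suc (suc m)) 2 a b
genView⇒gen (lower (alongRow i j j′ eq)) =
  subst₂ (Gen _ 2) (sym (low-combine i j)) (sym (low-combine i j′)) (alongRow (inject₁ i) j j′ eq)
genView⇒gen (lower (upColumn i i′ j eq)) =
  subst₂ (Gen _ 2) (sym (low-combine i′ j)) (sym (low-combine i j))
    (upColumn (inject₁ i) (inject₁ i′) j
      (trans (toℕ-inject₁ i′) (trans eq (cong suc (sym (toℕ-inject₁ i))))))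
genView⇒gen topRow      = gen-topRow _
genView⇒gen leftColumn  = gen-column _
genView⇒gen rightColumn = gen-column _

genView : ∀ {a b} → Gen (suc (suc m)) 2 a b → GenView m a b
genView {m} (alongRow i j j′ eq) with view i
genView {m} (alongRow _ zero (suc zero) eq) | ‵fromℕ =
  subst₂ (GenView m) (left-combine (suc m)) (right-combine (suc m)) topRow
genView {m} (alongRow _ (suc zero) (suc zero) ()) | ‵fromℕ
genView {m} (alongRow _ j j′ eq) | ‵inject₁ i =
  subst₂ (GenView m) (low-combine i j) (low-combine i j′) (lower (alongRow i j j′ eq))
genView {m} (upColumn i i′ j eq) with view i | view i′
... | ‵fromℕ | _ = contradiction (toℕ<n i′)
  (ℕ.≤⇒≯ (ℕ.≤-reflexive (sym (trans eq (cong suc (toℕ-fromℕ (suc m)))))))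
... | ‵inject₁ i₁ | ‵inject₁ i₁′ =
  subst₂ (GenView m) (low-combine i₁′ j) (low-combine i₁ j)
    (lower (upColumn i₁ i₁′ j
      (trans (sym (toℕ-inject₁ i₁′)) (trans eq (cong suc (toℕ-inject₁ i₁))))))
-- A column relation that starts in the new row ends in the row just below it, so `i₁` must be the
-- last of the old rows.
... | ‵inject₁ i₁ | ‵fromℕ
  with refl ← toℕ-injective {i = i₁} {j = fromℕ m} (ℕ.suc-injective
                (trans (cong suc (sym (toℕ-inject₁ i₁)))
                (trans (sym eq) (trans (toℕ-fromℕ (suc m)) (cong suc (sym (toℕ-fromℕ m)))))))
  with j
... | zero     = subst₂ (GenView m) (left-combine (suc m))
  (trans (cong low (left-combine m)) (low-combine (fromℕ m) zero)) leftColumn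
... | suc zero = subst₂ (GenView m) (right-combine (suc m))
  (trans (cong low (right-combine m)) (low-combine (fromℕ m) (suc zero))) rightColumn

-- Linear extensions before and after the insertion

-- Asks for the generating relations only. `Precedes` is transitive on words with distinct letters,
-- so this is equivalent to the condition for the closure, and it can be checked by cases on
-- `GenView`.
LinExt : ∀ m → Word (m * 2) (m * 2) → Set
LinExt m = IsLinearExtension (Gen m 2)

linExt⇒ : {π : Word (m * 2) (m * 2)} → LinExt m π → IsLinearExtension (EN-Order m 2) π
linExt⇒ {m} {π} (u , ext) = u , closure
  where
  closure : ∀ a b → EN-Order m 2 a b → Precedes π a b
  closure a b [ g ]    = ext a b g
  closure a b (g ∷ gs) = precedes-trans u (ext _ _ g) (closure _ b gs)

linExt⇐ : {π : Word (m * 2) (m * 2)} → IsLinearExtension (EN-Order m 2) π → LinExt m π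
linExt⇐ (u , ext) = u , λ a b g → ext a b [ g ]

first-minimal : {π : Word n (suc m)} → Unique π → ∀ {a} → ¬ Precedes π a (lookup π zero)
first-minimal u (k , l , k<l , _ , πl≡π0) with refl ← lookup-injective u l zero πl≡π0 = contradiction k<l λ ()

-- The left end of the top row is the only minimal element: `right` has `left` before it, and each
-- lower `x` has `x + 2` before it.
first-letter : {π : Word (suc m * 2) (suc m * 2)} → LinExt (suc m) π → lookup π zero ≡ left (m * 2)
first-letter {m} {π} (u , ext) with lookup π zero in eq
... | a with letter a
... | isLeft  = refl
... | isRight = contradiction (subst (Precedes π _) (sym eq) (ext _ _ (gen-topRow m))) (first-minimal u)
... | isLow x = contradiction (subst (Precedes π _) (sym eq) (ext _ _ (gen-column x))) (first-minimal u)

-- Only the relation in the right column restricts `p`. In `w` the right end of the row below has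
-- its left end before it, so its index is at least 1 and hence at least `p`; it lands after the
-- inserted letter.
linExt-ins : ∀ (p : Fin (suc (suc m * 2))) {w} → toℕ p ≤ 1 → LinExt (suc m) w → LinExt (suc (suc m)) (ins p w)
linExt-ins {m} p {w} p≤1 (u , ext) = unique-ins p u , λ a b → gen ∘ genView
  where
  gen : ∀ {a b} → GenView m a b → Precedes (ins p w) a b
  gen (lower g)  = precedes-ins p w (ext _ _ g)
  gen topRow     = zero , suc p , s≤s z≤n , refl , lookup-ins-right p w
  gen leftColumn = zero , slot p zero , s≤s z≤n , refl ,
    trans (lookup-ins-slot p w zero) (cong low (first-letter (u , ext)))
  gen rightColumn with k , l , k<l , _ , wl≡right ← ext _ _ (gen-topRow m) =
    suc p , slot p l , s≤s (p<punchIn p l (ℕ.≤-trans p≤1 (ℕ.≤-trans (s≤s z≤n) k<l))) ,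
    lookup-ins-right p w , trans (lookup-ins-slot p w l) (cong low wl≡right)

linExt-ins⁻ : ∀ (p : Fin (suc (suc m * 2))) {w} → LinExt (suc (suc m)) (ins p w) → LinExt (suc m) w
linExt-ins⁻ p {w} (u , ext) =
  unique-ins⁻ p u , λ a b g → precedes-ins⁻ p w (ext _ _ (genView⇒gen (lower g)))

-- If the right end of the top row comes later, then the word begins with the
-- letters at the left ends of three rows, and the last two of them form 2143
-- with the right ends of the first two rows.
right-early : ∀ (p : Fin (suc (suc m * 2))) {w} → LinExt (suc (suc m)) (ins p w) →
              ¬ Has2143 (ins p w) → toℕ p ≤ 1
right-early zero       _ _ = z≤n
right-early (suc zero) _ _ = s≤s z≤n
right-early {m} p@(suc (suc p′)) {w} le@(u , ext) avoids
  with k , l , k<l , πk≡ , πl≡ ← ext _ _ (genView⇒gen {m} rightColumn)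
  with refl ← lookup-injective u k (suc p) (trans πk≡ (sym (lookup-ins-right p w)))
  with j , refl , wj≡ ← slot-of-low p w {l} πl≡
  with lookup w (suc zero) in w1≡
... | a with letter a
... | isLeft =
  contradiction (lookup-injective (unique-ins⁻ p u) zero (suc zero) (trans w0≡ (sym w1≡))) λ ()
  where w0≡ = first-letter {m} (linExt-ins⁻ p le)
... | isRight
  with refl ← lookup-injective (unique-ins⁻ p u) j (suc zero) (trans wj≡ (sym w1≡)) =
  contradiction k<l λ { (s≤s (s≤s ())) }
... | isLow x = contradiction
  (occurrence {i = suc zero} {suc (suc zero)} {suc p} {slot p j}
    (s≤s (s≤s z≤n)) (s≤s (s≤s (s≤s z≤n))) k<l
    (lookup-ins-slot-< p w (subst₂ _<_ (sym w1≡) (sym w0≡) (low<left x)))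
    (lookup-ins-slot-< p w (subst₂ _<_ (sym w0≡) (sym wj≡) (left<right _)))
    (subst₂ _<_ (sym πl≡) (sym (lookup-ins-right p w)) (low<right _)))
  avoids
  where w0≡ = first-letter {m} (linExt-ins⁻ p le)

low-word : (v : Vec (Fin (2 + n)) m) → (∀ i → ∃ λ x → lookup v i ≡ low x) →
           ∃ λ (w : Word n m) → v ≡ map low w
low-word []      _ = [] , refl
low-word (a ∷ v) h with x , refl ← h zero | w , refl ← low-word v (h ∘ suc) = x ∷ w , refl

-- The word starts with `left`, the top row relation locates `right` at some `suc p`, and
-- distinctness of the letters makes all others low.
linExt⇒ins : {π : Word (suc (suc m) * 2) (suc (suc m) * 2)} → LinExt (suc (suc m)) π →
             ∃ λ p → ∃ λ w → π ≡ ins p w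
linExt⇒ins {m} {π = a ∷ v} le@(u , ext) with refl ← first-letter le | ext _ _ (gen-topRow (suc m))
... | zero  , zero  , () , _
... | _     , suc p , _ , _ , vp≡right =
  let w , r≡w = low-word (removeAt v p) rest in
  p , w , cong (left _ ∷_) (trans (sym (insertAt-removeAt v p)) (cong₂ (λ r → insertAt r p) r≡w vp≡right))
  where
  rest : ∀ i → ∃ λ x → lookup (removeAt v p) i ≡ low x
  -- Turns the entry `i` left after the deletion into the entry `punchIn p i` of `v`. The available
  -- law speaks of `punchOut`, so `i` is first written as a `punchOut`.
  rest i rewrite trans (cong (lookup (removeAt v p)) (sym (punchOut-punchIn p {i})))
                       (removeAt-punchOut v (punchInᵢ≢i p i ∘ sym))
    with lookup v (punchIn p i) in eq
  ... | b with letter b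
  ... | isLeft  = contradiction (lookup-injective u zero (slot p i) (sym eq)) λ ()
  ... | isRight = contradiction
    (suc-injective (lookup-injective u (slot p i) (suc p) (trans eq (sym vp≡right)))) (punchInᵢ≢i p i)
  ... | isLow x = x , refl

-- The recursion for the list of avoiders

allWords-unique : ∀ n m → List.Unique (allWords n m)
allWords-unique n zero    = [] ∷ []
allWords-unique n (suc m) = List.cartesianProductWith⁺ _∷_ ∷-injective (List.allFin⁺ n) (allWords-unique n m)

-- Abstract, since with-abstraction would otherwise normalise inEN?.
abstract

  avoiders : ∀ m → List (Word (suc m * 2) (suc m * 2))
  avoiders m = EN (suc m) 2 pattern2143

  avoiders≡EN : ∀ m → avoiders m ≡ EN (suc m) 2 pattern2143
  avoiders≡EN m = refl

  avoiders-zero : avoiders 0 ≡ (zero ∷ suc zero ∷ []) ∷ []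
  avoiders-zero = refl

  avoiders-unique : ∀ m → List.Unique (avoiders m)
  avoiders-unique m = List.filter⁺ (inEN? (suc m) 2 pattern2143) (allWords-unique (suc m * 2) (suc m * 2))

  ∈-avoiders⁺ : ∀ {π} → LinExt (suc m) π → ¬ Has2143 π → π ∈ avoiders m
  ∈-avoiders⁺ {m} {π} le avoids = ∈-filter⁺ (inEN? (suc m) 2 pattern2143) (allWords-complete π)
    (linExt⇒ le , avoids ∘ contains⇒has2143)

  ∈-avoiders⁻ : ∀ {π} → π ∈ avoiders m → LinExt (suc m) π × ¬ Has2143 π
  ∈-avoiders⁻ {m} π∈ = Product.map linExt⇐ (_∘ has2143⇒contains)
    (proj₂ (∈-filter⁻ (inEN? (suc m) 2 pattern2143) {xs = allWords (suc m * 2) (suc m * 2)} π∈))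

ins-injective : ∀ (p : Fin (suc n)) {w w′} → ins p w ≡ ins p w′ → w ≡ w′
ins-injective p {w} {w′} eq = lookup⇒≡ λ i → low-injective
  (trans (sym (lookup-ins-slot p w i)) (trans (cong (λ v → lookup v (slot p i)) eq) (lookup-ins-slot p w′ i)))
  where
  lookup⇒≡ : (∀ i → lookup w i ≡ lookup w′ i) → w ≡ w′
  lookup⇒≡ h = trans (sym (tabulate∘lookup w)) (trans (tabulate-cong h) (tabulate∘lookup w′))

children : ∀ m → List (Word (suc (suc m) * 2) (suc (suc m) * 2))
children m = List.map (ins zero) (avoiders m) List.++ List.map (ins (suc zero)) (avoiders m)

children-unique : ∀ m → List.Unique (children m)
children-unique m = List.++⁺
  (List.map⁺ (ins-injective zero) (avoiders-unique m))
  (List.map⁺ (ins-injective (suc zero)) (avoiders-unique m))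
  disjoint
  where
  disjoint : List.Disjoint (List.map (ins zero) (avoiders m)) (List.map (ins (suc zero)) (avoiders m))
  -- The second letter separates the two lists: it is the largest letter after `ins zero` and a low
  -- letter after `ins (suc zero)`.
  disjoint (π∈ , π∈′) with w , _ , refl ← ∈-map⁻ (ins zero) π∈ | w′ , _ , eq ← ∈-map⁻ (ins (suc zero)) π∈′ =
    low≢right (trans (sym (lookup-ins-slot (suc zero) w′ zero)) (cong (λ v → lookup v (suc zero)) (sym eq)))

-- Two duplicate-free lists with the same members are permutations of each other. This is enough, as
-- only sums over these lists are taken.
avoiders↭children : ∀ m → avoiders (suc m) ↭ children m
avoiders↭children m = ∼bag⇒↭ (unique∧set⇒bag (avoiders-unique (suc m)) (children-unique m) (mk⇔ to from))
  where
  to : ∀ {π} → π ∈ avoiders (suc m) → π ∈ children m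
  to π∈ with le , avoids ← ∈-avoiders⁻ {suc m} π∈ with linExt⇒ins {m} le
  ... | p , w , refl with right-early {m} p le avoids
                        | ∈-avoiders⁺ {m} (linExt-ins⁻ p le) (avoids ∘ has2143-ins p w)
  to π∈ | zero     , w , refl | _ | w∈ = ∈-++⁺ˡ (∈-map⁺ (ins zero) w∈)
  to π∈ | suc zero , w , refl | _ | w∈ = ∈-++⁺ʳ _ (∈-map⁺ (ins (suc zero)) w∈)
  to π∈ | suc (suc _) , w , refl | s≤s () | w∈

  ins∈ : ∀ p {w} → toℕ p ≤ 1 → w ∈ avoiders m → ins p w ∈ avoiders (suc m)
  ins∈ p p≤1 w∈ with le , avoids ← ∈-avoiders⁻ {m} w∈ =
    ∈-avoiders⁺ {suc m} (linExt-ins p p≤1 le) (avoids ∘ has2143-ins⁻ p _ p≤1)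

  from : ∀ {π} → π ∈ children m → π ∈ avoiders (suc m)
  from π∈ with ∈-++⁻ (List.map (ins zero) (avoiders m)) π∈
  ... | inj₁ π∈₀ with _ , w∈ , refl ← ∈-map⁻ (ins zero) π∈₀ = ins∈ zero z≤n w∈
  ... | inj₂ π∈₁ with _ , w∈ , refl ← ∈-map⁻ (ins (suc zero)) π∈₁ = ins∈ (suc zero) (s≤s z≤n) w∈

-- Counting inversions

length-filter-map : {A B : Set} {P : Pred A 0ℓ} {Q : Pred B 0ℓ} (P? : Decidable P) (Q? : Decidable Q)
  (f : A → B) → (∀ x → Q (f x) ⇔ P x) → ∀ xs → length (filter Q? (List.map f xs)) ≡ length (filter P? xs)
length-filter-map P? Q? f Q⇔P []       = refl
length-filter-map P? Q? f Q⇔P (x ∷ xs) with Q? (f x) | P? x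
... | yes _ | yes _ = cong suc (length-filter-map P? Q? f Q⇔P xs)
... | no  _ | no  _ = length-filter-map P? Q? f Q⇔P xs
... | yes q | no ¬p = contradiction (Equivalence.to (Q⇔P x) q) ¬p
... | no ¬q | yes p = contradiction (Equivalence.from (Q⇔P x) p) ¬q

module _ {A : Set} {P : Pred A 0ℓ} (P? : Decidable P) where

  count≡length-filter : (v : Vec A n) → count P? v ≡ length (filter (P? ∘ lookup v) (allFin n))
  count≡length-filter         []      = refl
  count≡length-filter {suc n} (x ∷ v) with P? x | rest
    where
    rest : count P? v ≡ length (filter (P? ∘ lookup (x ∷ v)) (List.tabulate suc))
    rest = begin
      count P? v                                                ≡⟨ count≡length-filter v ⟩
      length (filter (P? ∘ lookup v) (allFin n))
        ≡⟨ length-filter-map (P? ∘ lookup v) (P? ∘ lookup (x ∷ v)) suc (λ _ → mk⇔ id id) (allFin n) ⟨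
      length (filter (P? ∘ lookup (x ∷ v)) (List.map suc (allFin n)))
        ≡⟨ cong (length ∘ filter (P? ∘ lookup (x ∷ v))) (List.map-tabulate id suc) ⟩
      length (filter (P? ∘ lookup (x ∷ v)) (List.tabulate suc)) ∎
      where open ≡-Reasoning
  ... | yes _ | eq = cong suc eq
  ... | no  _ | eq = eq

  count-all : (v : Vec A n) → (∀ i → P (lookup v i)) → count P? v ≡ n
  count-all []      _ = refl
  count-all (x ∷ v) h with P? x
  ... | yes _ = cong suc (count-all v (h ∘ suc))
  ... | no ¬p = contradiction (h zero) ¬p

  count-insertAt : ∀ (v : Vec A n) p {x} → ¬ P x → count P? (insertAt v p x) ≡ count P? v
  count-insertAt v       zero    {x} ¬p with P? x
  ... | yes p = contradiction p ¬p
  ... | no  _ = refl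
  count-insertAt (y ∷ v) (suc p) ¬p with P? y
  ... | yes _ = cong suc (count-insertAt v p ¬p)
  ... | no  _ = count-insertAt v p ¬p

count-map : {A B : Set} {P : Pred A 0ℓ} {Q : Pred B 0ℓ} (P? : Decidable P) (Q? : Decidable Q)
  (f : A → B) → (∀ x → Q (f x) ⇔ P x) → (v : Vec A n) → count Q? (map f v) ≡ count P? v
count-map P? Q? f Q⇔P []      = refl
count-map P? Q? f Q⇔P (x ∷ v) with Q? (f x) | P? x
... | yes _ | yes _ = cong suc (count-map P? Q? f Q⇔P v)
... | no  _ | no  _ = count-map P? Q? f Q⇔P v
... | yes q | no ¬p = contradiction (Equivalence.to (Q⇔P x) q) ¬p
... | no ¬q | yes p = contradiction (Equivalence.from (Q⇔P x) p) ¬q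

-- Inversion for words of any length, so that the first letter can be split off.
InversionOf : Word n m → Pred (Fin m × Fin m) 0ℓ
InversionOf v (i , j) = i < j × lookup v j < lookup v i

inversionOf? : (v : Word n m) → Decidable (InversionOf v)
inversionOf? v (i , j) = i <? j ×-dec lookup v j <? lookup v i

inversions : Word n m → ℕ
inversions []      = 0
inversions (x ∷ v) = count (_<? x) v + inversions v

row : Word n m → Fin m → ℕ
row {m = m} v i = length (filter (inversionOf? v) (List.map (i ,_) (allFin m)))

-- The first indices range over an arbitrary list, so that the product of index lists can be peeled
-- off one first index at a time. For `allFin n` and a word of length `n` this unfolds to `inv`.
rows : Word n m → List (Fin m) → ℕ
rows {m = m} v is = length (filter (inversionOf? v) (cartesianProduct is (allFin m)))

rows-∷ : ∀ (v : Word n m) i is → rows v (i ∷ is) ≡ row v i + rows v is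
rows-∷ {m = m} v i is = trans
  (cong length (List.filter-++ (inversionOf? v) (List.map (i ,_) (allFin m)) (cartesianProduct is (allFin m))))
  (List.length-++ (filter (inversionOf? v) (List.map (i ,_) (allFin m)))
                  {filter (inversionOf? v) (cartesianProduct is (allFin m))})

-- No inversion has second index `zero`, so the second index can be taken to be `suc j`, with `P` as
-- the remaining condition on `j`.
row-tail : ∀ (x : Fin n) (v : Word n m) i {P : Pred (Fin m) 0ℓ} (P? : Decidable P) →
           (∀ j → InversionOf (x ∷ v) (i , suc j) ⇔ P j) → row (x ∷ v) i ≡ length (filter P? (allFin m))
row-tail {m = m} x v i P? equiv = begin
  row (x ∷ v) i
    ≡⟨ cong length (List.filter-reject (inversionOf? (x ∷ v)) 
         {x = i , zero} {xs = List.map (i ,_) (List.tabulate suc)} λ ()) ⟩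
  length (filter (inversionOf? (x ∷ v)) (List.map (i ,_) (List.tabulate suc)))
    ≡⟨ cong (length ∘ filter (inversionOf? (x ∷ v)) ∘ List.map (i ,_)) (List.map-tabulate id suc) ⟨
  length (filter (inversionOf? (x ∷ v)) (List.map (i ,_) (List.map suc (allFin m))))
    ≡⟨ cong (length ∘ filter (inversionOf? (x ∷ v))) (List.map-∘ (allFin m)) ⟨
  length (filter (inversionOf? (x ∷ v)) (List.map (λ j → i , suc j) (allFin m)))
    ≡⟨ length-filter-map P? (inversionOf? (x ∷ v)) (λ j → i , suc j) equiv (allFin m) ⟩
  length (filter P? (allFin m)) ∎
  where open ≡-Reasoning

row-zero : ∀ (x : Fin n) (v : Word n m) → row (x ∷ v) zero ≡ count (_<? x) v
row-zero x v = trans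
  (row-tail x v zero ((_<? x) ∘ lookup v) λ j → mk⇔ proj₂ (s≤s z≤n ,_))
  (sym (count≡length-filter (_<? x) v))

row-suc : ∀ (x : Fin n) (v : Word n m) i → row (x ∷ v) (suc i) ≡ row v i
row-suc x v i = trans
  (row-tail x v (suc i) (inversionOf? v ∘ (i ,_)) λ j →
    mk⇔ (λ (i<j , πj<πi) → s≤s⁻¹ i<j , πj<πi) (λ (i<j , πj<πi) → s≤s i<j , πj<πi))
  (sym (length-filter-map (inversionOf? v ∘ (i ,_)) (inversionOf? v) (i ,_) (λ _ → mk⇔ id id) (allFin _)))

rows-suc : ∀ (x : Fin n) (v : Word n m) is → rows (x ∷ v) (List.map suc is) ≡ rows v is
rows-suc x v []       = refl
rows-suc x v (i ∷ is) = begin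
  rows (x ∷ v) (suc i ∷ List.map suc is)             ≡⟨ rows-∷ (x ∷ v) (suc i) (List.map suc is) ⟩
  row (x ∷ v) (suc i) + rows (x ∷ v) (List.map suc is) ≡⟨ cong₂ _+_ (row-suc x v i) (rows-suc x v is) ⟩
  row v i + rows v is                                ≡⟨ rows-∷ v i is ⟨
  rows v (i ∷ is)                                    ∎
  where open ≡-Reasoning

rows≡inversions : (v : Word n m) → rows v (allFin m) ≡ inversions v
rows≡inversions         []      = refl
rows≡inversions {m = suc m} (x ∷ v) = begin
  rows (x ∷ v) (allFin (suc m))
    ≡⟨ rows-∷ (x ∷ v) zero (List.tabulate suc) ⟩
  row (x ∷ v) zero + rows (x ∷ v) (List.tabulate suc)
    ≡⟨ cong (λ is → row (x ∷ v) zero + rows (x ∷ v) is) (List.map-tabulate id suc) ⟨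
  row (x ∷ v) zero + rows (x ∷ v) (List.map suc (allFin m))
    ≡⟨ cong₂ _+_ (row-zero x v) (trans (rows-suc x v (allFin m)) (rows≡inversions v)) ⟩
  inversions (x ∷ v) ∎
  where open ≡-Reasoning

inv≡inversions : (π : Word n n) → inv π ≡ inversions π
inv≡inversions = rows≡inversions

low-<⇔ : ∀ (x y : Fin n) → low y < low x ⇔ y < x
low-<⇔ x y = mk⇔ low-cancel-< low-mono-<

inversions-low : (v : Word n m) → inversions (map low v) ≡ inversions v
inversions-low []      = refl
inversions-low (x ∷ v) = cong₂ _+_ (count-map (_<? x) (_<? low x) low (low-<⇔ x) v) (inversions-low v)

count-low : ∀ (a : Fin (2 + n)) (v : Word n m) → (∀ x → low x < a) → count (_<? a) (map low v) ≡ m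
count-low a v low<a = count-all (_<? a) (map low v) λ i → subst (_< a) (sym (lookup-map i low v)) (low<a _)

-- The leading letter exceeds the `n` low letters but not the largest one, so it adds `n` inversions
-- whatever `p` is.
inv-ins : ∀ p (w : Word n n) → inv (ins p w) ≡ n + inversions (insertAt (map low w) p (right n))
inv-ins {n} p w = trans (inv≡inversions (ins p w)) (cong (_+ inversions (insertAt (map low w) p (right n)))
  (trans (count-insertAt (_<? left n) (map low w) p (right-max (left n))) (count-low (left n) w low<left)))

inv-ins-zero : (w : Word n n) → inv (ins zero w) ≡ n + (n + inv w)
inv-ins-zero {n} w = trans (inv-ins zero w) (cong (n +_) (cong₂ _+_
  (count-low (right n) w low<right) (trans (inversions-low w) (sym (inv≡inversions w)))))

+-leftComm : ∀ a b c → a + (b + c) ≡ b + (a + c)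
+-leftComm = solve-∀

-- The low letter `x` now stands before the largest letter, which therefore exceeds only `n` of the
-- `suc n` low letters to its right or left from the right.
inv-ins-one : (w : Word (suc n) (suc n)) → inv (ins (suc zero) w) ≡ suc n + (n + inv w)
inv-ins-one {n} w@(x ∷ v) = trans (inv-ins (suc zero) w) (cong (suc n +_) (begin
  count (_<? low x) (right (suc n) ∷ map low v) + (count (_<? right (suc n)) (map low v) + inversions (map low v))
    ≡⟨ cong₂ _+_
         (trans (count-insertAt (_<? low x) (map low v) zero (right-max (low x)))
                (count-map (_<? x) (_<? low x) low (low-<⇔ x) v))
         (cong₂ _+_ (count-low (right (suc n)) v low<right) (inversions-low v)) ⟩
  count (_<? x) v + (n + inversions v) ≡⟨ +-leftComm (count (_<? x) v) n (inversions v) ⟩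
  n + inversions w                     ≡⟨ cong (n +_) (inv≡inversions w) ⟨
  n + inv w                            ∎))
  where open ≡-Reasoning

-- Polynomial identities, coefficient by coefficient

coeff-+ : ∀ f g k → coeff (f +ₚ g) k ≡ coeff f k + coeff g k
coeff-+ []      g       k       = refl
coeff-+ (a ∷ f) []      k       = sym (ℕ.+-identityʳ _)
coeff-+ (a ∷ f) (b ∷ g) zero    = refl
coeff-+ (a ∷ f) (b ∷ g) (suc k) = coeff-+ f g k

coeff-scale : ∀ a f k → coeff (List.map (a *_) f) k ≡ a * coeff f k
coeff-scale a []      k       = sym (ℕ.*-zeroʳ a)
coeff-scale a (b ∷ f) zero    = refl
coeff-scale a (b ∷ f) (suc k) = coeff-scale a f k

coeff-∷-* : ∀ a f g k → coeff ((a ∷ f) *ₚ g) k ≡ a * coeff g k + coeff (0 ∷ f *ₚ g) k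
coeff-∷-* a f g k = trans (coeff-+ (List.map (a *_) g) (0 ∷ f *ₚ g) k)
  (cong (_+ coeff (0 ∷ f *ₚ g) k) (coeff-scale a g k))

0∷[]≈0 : (0 ∷ []) ≈ₚ 0ₚ
0∷[]≈0 zero    = refl
0∷[]≈0 (suc k) = refl

0∷-cong : ∀ {f g} → f ≈ₚ g → (0 ∷ f) ≈ₚ (0 ∷ g)
0∷-cong f≈g zero    = refl
0∷-cong f≈g (suc k) = f≈g k

-- A list of zeros represents 0 without being empty. This case arises in `*ₚ-congʳ` when one of two
-- equal polynomials is the shorter list.
*ₚ-zeroˡ : ∀ f g → f ≈ₚ 0ₚ → f *ₚ g ≈ₚ 0ₚ
*ₚ-zeroˡ []      g f≈0 k = refl
*ₚ-zeroˡ (a ∷ f) g f≈0 k = begin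
  coeff ((a ∷ f) *ₚ g) k                ≡⟨ coeff-∷-* a f g k ⟩
  a * coeff g k + coeff (0 ∷ f *ₚ g) k  ≡⟨ cong₂ _+_ (cong (_* coeff g k) (f≈0 zero))
                                             (0∷-cong (*ₚ-zeroˡ f g (f≈0 ∘ suc)) k) ⟩
  coeff (0 ∷ []) k                      ≡⟨ 0∷[]≈0 k ⟩
  0                                     ∎
  where open ≡-Reasoning

*ₚ-congʳ : ∀ f f′ g → f ≈ₚ f′ → f *ₚ g ≈ₚ f′ *ₚ g
*ₚ-congʳ []      f′       g f≈f′ k = sym (*ₚ-zeroˡ f′ g (sym ∘ f≈f′) k)
*ₚ-congʳ (a ∷ f) []       g f≈f′ k = *ₚ-zeroˡ (a ∷ f) g f≈f′ k
*ₚ-congʳ (a ∷ f) (b ∷ f′) g f≈f′ k = begin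
  coeff ((a ∷ f) *ₚ g) k                ≡⟨ coeff-∷-* a f g k ⟩
  a * coeff g k + coeff (0 ∷ f *ₚ g) k  ≡⟨ cong₂ _+_ (cong (_* coeff g k) (f≈f′ zero))
                                             (0∷-cong (*ₚ-congʳ f f′ g (f≈f′ ∘ suc)) k) ⟩
  b * coeff g k + coeff (0 ∷ f′ *ₚ g) k ≡⟨ coeff-∷-* b f′ g k ⟨
  coeff ((b ∷ f′) *ₚ g) k               ∎
  where open ≡-Reasoning

*ₚ-identityˡ : ∀ f → 1ₚ *ₚ f ≈ₚ f
*ₚ-identityˡ f k = trans (coeff-∷-* 1 [] f k)
  (trans (cong₂ _+_ (ℕ.*-identityˡ (coeff f k)) (0∷[]≈0 k)) (ℕ.+-identityʳ _))

*ₚ-identityʳ : ∀ f → f *ₚ 1ₚ ≈ₚ f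
*ₚ-identityʳ []      k       = refl
*ₚ-identityʳ (a ∷ f) zero    = trans (ℕ.+-identityʳ (a * 1)) (ℕ.*-identityʳ a)
*ₚ-identityʳ (a ∷ f) (suc k) = *ₚ-identityʳ f k

q*≈0∷ : ∀ f → q *ₚ f ≈ₚ (0 ∷ f)
q*≈0∷ f k = trans (coeff-∷-* 0 1ₚ f k) (0∷-cong (*ₚ-identityˡ f) k)

-- Multiplication by `q` is a shift of the coefficient list, and a shift passes through a right
-- factor.
q*-assoc : ∀ f g → (q *ₚ f) *ₚ g ≈ₚ (0 ∷ f *ₚ g)
q*-assoc f g k = trans (*ₚ-congʳ (q *ₚ f) (0 ∷ f) g (q*≈0∷ f) k) (coeff-∷-* 0 f g k)

1+q-* : ∀ f k → coeff ((1ₚ +ₚ q) *ₚ f) k ≡ coeff (0 ∷ f) k + coeff f k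
1+q-* f k = begin
  coeff ((1ₚ +ₚ q) *ₚ f) k                ≡⟨ coeff-∷-* 1 1ₚ f k ⟩
  1 * coeff f k + coeff (0 ∷ 1ₚ *ₚ f) k   ≡⟨ cong₂ _+_ (ℕ.*-identityˡ (coeff f k)) (0∷-cong (*ₚ-identityˡ f) k) ⟩
  coeff f k + coeff (0 ∷ f) k             ≡⟨ ℕ.+-comm (coeff f k) _ ⟩
  coeff (0 ∷ f) k + coeff f k             ∎
  where open ≡-Reasoning

-- Merges the contributions of the two insertions. By induction on `c`: each factor `q` shifts both
-- sides by one, down to the case `f` times `1 + q`.
q^-*-1+q : ∀ c f k → coeff (q ^ₚ suc c *ₚ f) k + coeff (q ^ₚ c *ₚ f) k ≡ coeff (q ^ₚ c *ₚ ((1ₚ +ₚ q) *ₚ f)) k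
q^-*-1+q zero f k = begin
  coeff (q ^ₚ 1 *ₚ f) k + coeff (1ₚ *ₚ f) k
    ≡⟨ cong₂ _+_ (trans (q*-assoc 1ₚ f k) (0∷-cong (*ₚ-identityˡ f) k)) (*ₚ-identityˡ f k) ⟩
  coeff (0 ∷ f) k + coeff f k               ≡⟨ 1+q-* f k ⟨
  coeff ((1ₚ +ₚ q) *ₚ f) k                  ≡⟨ *ₚ-identityˡ ((1ₚ +ₚ q) *ₚ f) k ⟨
  coeff (1ₚ *ₚ ((1ₚ +ₚ q) *ₚ f)) k          ∎
  where open ≡-Reasoning
q^-*-1+q (suc c) f k = begin
  coeff (q ^ₚ suc (suc c) *ₚ f) k + coeff (q ^ₚ suc c *ₚ f) k
    ≡⟨ cong₂ _+_ (q*-assoc (q ^ₚ suc c) f k) (q*-assoc (q ^ₚ c) f k) ⟩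
  coeff (0 ∷ q ^ₚ suc c *ₚ f) k + coeff (0 ∷ q ^ₚ c *ₚ f) k
    ≡⟨ step k ⟩
  coeff (0 ∷ q ^ₚ c *ₚ ((1ₚ +ₚ q) *ₚ f)) k
    ≡⟨ q*-assoc (q ^ₚ c) ((1ₚ +ₚ q) *ₚ f) k ⟨
  coeff (q ^ₚ suc c *ₚ ((1ₚ +ₚ q) *ₚ f)) k ∎
  where
  open ≡-Reasoning
  step : ∀ k → coeff (0 ∷ q ^ₚ suc c *ₚ f) k + coeff (0 ∷ q ^ₚ c *ₚ f) k ≡ coeff (0 ∷ q ^ₚ c *ₚ ((1ₚ +ₚ q) *ₚ f)) k
  step zero    = refl
  step (suc k) = q^-*-1+q c f k

coeff-sum : ∀ {A : Set} (f : A → Poly) xs k →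
            coeff (foldr _+ₚ_ 0ₚ (List.map f xs)) k ≡ sum (List.map (λ x → coeff (f x) k) xs)
coeff-sum f []       k = refl
coeff-sum f (x ∷ xs) k = trans (coeff-+ (f x) _ k) (cong (coeff (f x) k +_) (coeff-sum f xs k))

-- Summing over the recursion

-- The least inversion number of an avoider on `m + 1` rows, reached by always taking the later
-- place for the largest letter: with `N = suc m * 2`, a step then adds `N + (N - 1)`.
minInv : ℕ → ℕ
minInv zero    = 0
minInv (suc m) = suc m * 2 + suc (m * 2) + minInv m

minInv-closed : ∀ m → minInv m ≡ (2 * suc m ∸ 1) * m
minInv-closed m = trans (closed m) (cong (λ x → (x ∸ 1) * m) (ℕ.*-comm (suc m) 2))
  where
  -- With the product in the order `suc m * 2`, the truncated subtraction evaluates to `1 + m * 2`,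
  -- which leaves `arith` free of subtraction.
  closed : ∀ m → minInv m ≡ (suc m * 2 ∸ 1) * m
  closed zero    = refl
  closed (suc m) = trans (cong (suc m * 2 + suc (m * 2) +_) (closed m)) (arith m)
    where
    arith : ∀ m → suc m * 2 + suc (m * 2) + (1 + m * 2) * m ≡ (3 + m * 2) * suc m
    arith = solve-∀

-- The offset `a` is there for the induction: the inversions added by an insertion are moved into
-- it, and the hypothesis is applied at the larger offset.
sum-shifted : ∀ m a k → sum (List.map (λ π → coeff (q ^ₚ (a + inv π)) k) (avoiders m))
                      ≡ coeff (q ^ₚ (a + minInv m) *ₚ (1ₚ +ₚ q) ^ₚ m) k
sum-shifted zero a k rewrite avoiders-zero = trans (ℕ.+-identityʳ _) (sym (*ₚ-identityʳ (q ^ₚ (a + 0)) k))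
sum-shifted (suc m) a k = begin
  sum (List.map (term a) (avoiders (suc m)))
    ≡⟨ sum-↭ (↭-map⁺ (term a) (avoiders↭children m)) ⟩
  sum (List.map (term a) (children m))
    ≡⟨ cong sum (List.map-++ (term a) (List.map (ins zero) ws) (List.map (ins (suc zero)) ws)) ⟩
  sum (List.map (term a) (List.map (ins zero) ws) List.++ List.map (term a) (List.map (ins (suc zero)) ws))
    ≡⟨ sum-++ (List.map (term a) (List.map (ins zero) ws)) _ ⟩
  sum (List.map (term a) (List.map (ins zero) ws)) + sum (List.map (term a) (List.map (ins (suc zero)) ws))
    ≡⟨ cong₂ _+_ (branch zero (suc m * 2) inv-ins-zero) (branch (suc zero) (suc (m * 2)) inv-ins-one) ⟩
  coeff (q ^ₚ (a + (N + N) + minInv m) *ₚ Q) k + coeff (q ^ₚ (a + (N + suc (m * 2)) + minInv m) *ₚ Q) k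
    -- `N` is the successor of `suc (m * 2)`, so the two exponents are the consecutive numbers
    -- `suc c` and `c`.
    ≡⟨ cong₂ (λ x y → coeff (q ^ₚ x *ₚ Q) k + coeff (q ^ₚ y *ₚ Q) k) exponent₀ exponent₁ ⟩
  coeff (q ^ₚ suc c *ₚ Q) k + coeff (q ^ₚ c *ₚ Q) k
    ≡⟨ q^-*-1+q c Q k ⟩
  coeff (q ^ₚ c *ₚ (1ₚ +ₚ q) ^ₚ suc m) k ∎
  where
  open ≡-Reasoning
  N   = suc m * 2
  c   = a + minInv (suc m)
  Q   = (1ₚ +ₚ q) ^ₚ m
  ws = avoiders m

  term : ∀ {n} → ℕ → Word n n → ℕ
  term b π = coeff (q ^ₚ (b + inv π)) k

  branch : ∀ p d → (∀ w → inv (ins p w) ≡ N + (d + inv w)) →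
           sum (List.map (term a) (List.map (ins p) ws)) ≡ coeff (q ^ₚ (a + (N + d) + minInv m) *ₚ Q) k
  branch p d inv≡ = begin
    sum (List.map (term a) (List.map (ins p) ws)) ≡⟨ cong sum (List.map-∘ ws) ⟨
    sum (List.map (term a ∘ ins p) ws)            ≡⟨ cong sum (List.map-cong same ws) ⟩
    sum (List.map (term (a + (N + d))) ws)        ≡⟨ sum-shifted m (a + (N + d)) k ⟩
    coeff (q ^ₚ (a + (N + d) + minInv m) *ₚ Q) k   ∎
    where
    same : ∀ w → term a (ins p w) ≡ term (a + (N + d)) w
    same w = cong (λ x → coeff (q ^ₚ x) k) (trans (cong (a +_) (trans (inv≡ w) (sym (ℕ.+-assoc N d (inv w)))))
                                                  (sym (ℕ.+-assoc a (N + d) (inv w))))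

  exponent₁ : a + (N + suc (m * 2)) + minInv m ≡ c
  exponent₁ = ℕ.+-assoc a _ (minInv m)

  exponent₀ : a + (N + N) + minInv m ≡ suc c
  exponent₀ = trans (cong (λ x → a + x + minInv m) (ℕ.+-suc N (suc (m * 2))))
              (trans (cong (_+ minInv m) (ℕ.+-suc a (N + suc (m * 2)))) (cong suc exponent₁))

theorem3p2 : ∀ (s : ℕ) → s ≥ 1 →
    ENPoly s 2 pattern2143 ≈ₚ q ^ₚ ((2 * s ∸ 1) * (s ∸ 1)) *ₚ (1ₚ +ₚ q) ^ₚ (s ∸ 1)
theorem3p2 (suc m) _ k = begin
  coeff (ENPoly (suc m) 2 pattern2143) k
    ≡⟨ coeff-sum (λ π → q ^ₚ inv π) (EN (suc m) 2 pattern2143) k ⟩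
  sum (List.map (λ π → coeff (q ^ₚ inv π) k) (EN (suc m) 2 pattern2143))
    ≡⟨ cong (λ πs → sum (List.map (λ π → coeff (q ^ₚ inv π) k) πs)) (avoiders≡EN m) ⟨
  sum (List.map (λ π → coeff (q ^ₚ inv π) k) (avoiders m))
    ≡⟨ sum-shifted m 0 k ⟩
  coeff (q ^ₚ minInv m *ₚ (1ₚ +ₚ q) ^ₚ m) k
    ≡⟨ cong (λ x → coeff (q ^ₚ x *ₚ (1ₚ +ₚ q) ^ₚ m) k) (minInv-closed m) ⟩
  coeff (q ^ₚ ((2 * suc m ∸ 1) * m) *ₚ (1ₚ +ₚ q) ^ₚ m) k ∎
  where open ≡-Reasoning
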